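{- Let $R$ be a discrete valuation ring with maximal ideal $\mathfrak{m}_R$ and field of fractions $K$. Let $\widehat{K}$ be the completion of $K$ with respect to the $\mathfrak{m}_R$-adic valuation $v_{\mathfrak{m}_R}$, let $\widehat{v_{\mathfrak{m}_R}}:\widehat{K}\to\mathbb{Z}_{\mathrm{m}0}$ be the valuation extending $v_{\mathfrak{m}_R}$ by continuity, and let $\widehat{K}^\circ=\{x\in\widehat{K}:\widehat{v_{\mathfrak{m}_R}}(x)\le 1\}$, which is a discrete valuation ring with field of fractions $\widehat{K}$ and whose maximal ideal is denoted $\widehat{\mathfrak{m}_R}$. Let $v_{\widehat{\mathfrak{m}_R}}:\widehat{K}\to\mathbb{Z}_{\mathrm{m}0}$ be the $\widehat{\mathfrak{m}_R}$-adic valuation. Then $v_{\widehat{\mathfrak{m}_R}}(x)=\widehat{v_{\mathfrak{m}_R}}(x)$ for every $x\in\widehat{K}$.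
   Context: $\mathbb{Z}_{\mathrm{m}0}$ is the linearly ordered commutative group with zero obtained from the multiplicatively written ordered group $\mathbb{Z}$ (elements $\mathrm{of\_add}(n)$, $n\in\mathbb{Z}$, with $\mathrm{of\_add}(a+b)=\mathrm{of\_add}(a)\,\mathrm{of\_add}(b)$, ordered as $\mathbb{Z}$) by adjoining an absorbing smallest element $0$. A valuation on a commutative unitary ring $A$ is a function $v: A\to \mathbb{Z}_{\mathrm{m}0}$ with $v(0)=0$, $v(1)=1$, $v(xy)=v(x)v(y)$ and $v(x+y)\le\max\{v(x),v(y)\}$ for all $x,y$. For a maximal ideal $\mathfrak m$ of a Dedekind domain $A$ that is not a field, with fraction field $F$, the $\mathfrak{m}$-adic valuation on $F$ is given by $v_{\mathfrak m}(0)=0$ and $v_{\mathfrak m}(r/s)=\mathrm{of\_add}(-(a(r)-a(s)))$ for nonzero $r,s\in A$, where $a(r)$ is the exponent of $\mathfrak{m}$ in the factorization of $(r)$ into maximal ideals. A valuation $v$ on a field $F$ induces a uniform structure, for which the sets $\{x : v(x)\le\gamma\}$, $\gamma\ne 0$, form a basis of neighborhoods of $0$; the completion is the completion of this uniform space, which is again a field, and $v$ extends uniquely by continuity to a valuation on it. A discrete valuation ring is a local principal ideal domain that is not a field. -}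

module Defs where

open import Level using (Level; _⊔_; suc; Lift; lift)
open import Algebra.Bundles using (CommutativeRing)
open import Algebra.Morphism.Structures using (module RingMorphisms)
import Algebra.Construct.NaturalChoice.Max as NaturalMax
import Algebra.Properties.Ring as RingProperties
open import Data.Empty using (⊥; ⊥-elim)
open import Data.Integer.Base as ℤ using (ℤ; +_; -[1+_])
import Data.Integer.Properties as ℤ
open import Data.List.Base using (List; []; _∷_; foldr)
open import Data.List.Relation.Unary.All using (All)
open import Data.Nat.Base as ℕ using (ℕ)
open import Data.Product.Base using (Σ; ∃; ∃-syntax; _×_; _,_; proj₁; proj₂)
open import Data.Sum.Base using (_⊎_; inj₁; inj₂)
open import Data.Unit.Base using (⊤; tt)
open import Function.Base using (flip)
open import Function.Bundles using (_⇔_)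
open import Relation.Binary.Bundles using (Setoid; TotalOrder)
open import Relation.Binary.Core using (Rel; _⇒_)
import Relation.Binary.Construct.Add.Infimum.NonStrict as NonStrict
open import Relation.Binary.Construct.Intersection using () renaming (_∩_ to _∩₂_)
open import Relation.Binary.PropositionalEquality
  using (_≡_; refl; sym; trans; cong; cong₂; subst)
open import Relation.Nullary.Construct.Add.Infimum using (_₋; ⊥₋; [_])
open import Relation.Nullary.Decidable.Core using (yes; no)
open import Relation.Nullary.Negation using (¬_)
open import Relation.Unary using (Pred; _⊆_; _≐_; _∩_)

-- ℤ written multiplicatively, with ⊥₋ adjoined as absorbing smallest element.

ℤₘ₀ : Set
ℤₘ₀ = ℤ ₋

of-add : ℤ → ℤₘ₀
of-add = [_]

0ₘ 1ₘ : ℤₘ₀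
0ₘ = ⊥₋
1ₘ = of-add (+ 0)

infixl 7 _·_

_·_ : ℤₘ₀ → ℤₘ₀ → ℤₘ₀
⊥₋    · _     = ⊥₋
[ _ ] · ⊥₋    = ⊥₋
[ a ] · [ b ] = [ a ℤ.+ b ]

open NonStrict ℤ._≤_ public using () renaming (_≤₋_ to _≤ₘ_)
private module ≤ = NonStrict ℤ._≤_

≤ₘ-totalOrder : TotalOrder _ _ _
≤ₘ-totalOrder = record { isTotalOrder = ≤.≤₋-isTotalOrder-≡ ℤ.≤-isTotalOrder }

open NaturalMax ≤ₘ-totalOrder public using () renaming (_⊔_ to max)

≤ₘ-trans : ∀ {x y z} → x ≤ₘ y → y ≤ₘ z → x ≤ₘ z
≤ₘ-trans = ≤.≤₋-trans ℤ.≤-trans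

≤ₘ-refl : ∀ {x} → x ≤ₘ x
≤ₘ-refl = ≤.≤₋-reflexive-≡ ℤ.≤-reflexive refl

≤ₘ-respˡ : ∀ {x y z} → x ≡ y → x ≤ₘ z → y ≤ₘ z
≤ₘ-respˡ refl p = p

max-≤ : ∀ {x y z} → x ≤ₘ z → y ≤ₘ z → max x y ≤ₘ z
max-≤ = NaturalMax.⊔-lub ≤ₘ-totalOrder

·-≤1 : ∀ {x y} → x ≤ₘ 1ₘ → y ≤ₘ 1ₘ → x · y ≤ₘ 1ₘ
·-≤1 (≤.⊥₋≤ _) _         = ≤.⊥₋≤ _
·-≤1 ≤.[ _ ]   (≤.⊥₋≤ _) = ≤.⊥₋≤ _
·-≤1 ≤.[ p ]   ≤.[ q ]   = ≤.[ ℤ.+-mono-≤ p q ]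

·-identityˡ : ∀ x → 1ₘ · x ≡ x
·-identityˡ ⊥₋    = refl
·-identityˡ [ n ] = cong [_] (ℤ.+-identityˡ n)

square≡1⇒≡1 : ∀ x → x · x ≡ 1ₘ → x ≡ 1ₘ
square≡1⇒≡1 ⊥₋               ()
square≡1⇒≡1 [ + ℕ.zero ]     _ = refl
square≡1⇒≡1 [ + (ℕ.suc _) ]  ()
square≡1⇒≡1 [ -[1+ _ ] ]     ()

module _ {c ℓ} (A : CommutativeRing c ℓ) where
  open CommutativeRing A

  IsIntegralDomain : Set (c ⊔ ℓ)
  IsIntegralDomain =
    ¬ (1# ≈ 0#) × (∀ x y → x * y ≈ 0# → (x ≈ 0#) ⊎ (y ≈ 0#))

  IsField : Set (c ⊔ ℓ)
  IsField = ¬ (1# ≈ 0#) × (∀ x → ¬ (x ≈ 0#) → ∃[ y ] x * y ≈ 1#)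

  record Ideal : Set (suc (c ⊔ ℓ)) where
    field
      members  : Pred Carrier (c ⊔ ℓ)
      resp     : ∀ {x y} → x ≈ y → members x → members y
      has-0    : members 0#
      +-closed : ∀ {x y} → members x → members y → members (x + y)
      absorb   : ∀ a {x} → members x → members (a * x)

  open Ideal

  principal : Carrier → Ideal
  principal g = record
    { members  = λ x → ∃[ a ] x ≈ a * g
    ; resp     = λ { x≈y (a , p) → a , A-trans (A-sym x≈y) p }
    ; has-0    = 0# , A-sym (zeroˡ g)
    ; +-closed = λ { (a , p) (b , q) →
                   a + b , A-trans (+-cong p q) (A-sym (distribʳ g a b)) }
    ; absorb   = λ { a (b , p) →
                   a * b , A-trans (*-congˡ p) (A-sym (*-assoc a b g)) }
    }
    where open Setoid setoid using () renaming (sym to A-sym; trans to A-trans)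

  unitIdeal : Ideal
  unitIdeal = record
    { members  = λ _ → Lift (c ⊔ ℓ) ⊤
    ; resp     = λ _ _ → lift tt
    ; has-0    = lift tt
    ; +-closed = λ _ _ → lift tt
    ; absorb   = λ _ _ → lift tt
    }

  -- Finite sums of products of an element of I and an element of J.
  data ProductMember (I J : Ideal) : Pred Carrier (c ⊔ ℓ) where
    empty-sum : ∀ {x} → x ≈ 0# → ProductMember I J x
    add-term  : ∀ {x y} a b → members I a → members J b →
                ProductMember I J y → x ≈ a * b + y → ProductMember I J x

  private
    module E = Setoid setoid

    product-resp : ∀ {I J x y} → x ≈ y →
                   ProductMember I J x → ProductMember I J y
    product-resp e (empty-sum p)          = empty-sum (E.trans (E.sym e) p)
    product-resp e (add-term a b i j m p) =
      add-term a b i j m (E.trans (E.sym e) p)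

    product-+ : ∀ {I J x y} → ProductMember I J x → ProductMember I J y →
                ProductMember I J (x + y)
    product-+ (empty-sum p) n =
      product-resp (E.trans (E.sym (+-identityˡ _)) (+-congʳ (E.sym p))) n
    product-+ (add-term a b i j m p) n =
      add-term a b i j (product-+ m n) (E.trans (+-congʳ p) (+-assoc _ _ _))

    product-absorb : ∀ {I J} r {x} → ProductMember I J x →
                     ProductMember I J (r * x)
    product-absorb r (empty-sum p) = empty-sum (E.trans (*-congˡ p) (zeroʳ r))
    product-absorb {I} r (add-term a b i j m p) =
      add-term (r * a) b (absorb I r i) j (product-absorb r m)
        (E.trans (*-congˡ p)
          (E.trans (distribˡ _ _ _) (+-congʳ (E.sym (*-assoc _ _ _)))))

  _*ᴵ_ : Ideal → Ideal → Ideal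
  I *ᴵ J = record
    { members  = ProductMember I J
    ; resp     = product-resp
    ; has-0    = empty-sum E.refl
    ; +-closed = product-+
    ; absorb   = product-absorb
    }

  ∏ : List Ideal → Ideal
  ∏ = foldr _*ᴵ_ unitIdeal

  _≐ᴵ_ : Rel Ideal (c ⊔ ℓ)
  I ≐ᴵ J = members I ≐ members J

  IsProper : Pred Ideal (c ⊔ ℓ)
  IsProper I = ¬ members I 1#

  IsMaximal : Pred Ideal (suc (c ⊔ ℓ))
  IsMaximal 𝔪 =
    IsProper 𝔪 × (∀ J → IsProper J → members 𝔪 ⊆ members J → J ≐ᴵ 𝔪)

  data Multiplicity (𝔪 : Ideal) : List Ideal → ℕ → Set (suc (c ⊔ ℓ)) where
    []   : Multiplicity 𝔪 [] 0
    hit  : ∀ {I Is n} → I ≐ᴵ 𝔪 →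
           Multiplicity 𝔪 Is n → Multiplicity 𝔪 (I ∷ Is) (ℕ.suc n)
    miss : ∀ {I Is n} → ¬ (I ≐ᴵ 𝔪) →
           Multiplicity 𝔪 Is n → Multiplicity 𝔪 (I ∷ Is) n

  -- n is the exponent of 𝔪 in a factorization of (r) into maximal ideals.
  IsExponent : Ideal → Carrier → ℕ → Set (suc (c ⊔ ℓ))
  IsExponent 𝔪 r n = ∃[ Is ]
    All IsMaximal Is × ∏ Is ≐ᴵ principal r × Multiplicity 𝔪 Is n

record DiscreteValuationRing c ℓ : Set (suc (c ⊔ ℓ)) where
  field
    ring             : CommutativeRing c ℓ
    isIntegralDomain : IsIntegralDomain ring
    isPrincipal      : ∀ I → ∃[ g ] _≐ᴵ_ ring I (principal ring g)
    maximalIdeal     : Ideal ring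
    isMaximal        : IsMaximal ring maximalIdeal
    uniqueMaximal    : ∀ I → IsMaximal ring I → _≐ᴵ_ ring I maximalIdeal
    notField         : ¬ IsField ring

module _ {c ℓ c′ ℓ′} (A : CommutativeRing c ℓ) (B : CommutativeRing c′ ℓ′) where
  private
    module A = CommutativeRing A
    module B = CommutativeRing B
  open RingMorphisms A.rawRing B.rawRing public
    using (IsRingHomomorphism; IsRingMonomorphism)

record FractionField {c ℓ} (A : CommutativeRing c ℓ) c′ ℓ′
       : Set (c ⊔ ℓ ⊔ suc (c′ ⊔ ℓ′)) where
  private module A = CommutativeRing A
  field
    ring    : CommutativeRing c′ ℓ′
    isField : IsField ring
  open CommutativeRing ring using (Carrier; _≈_; _*_; 0#)
  field
    ι              : A.Carrier → Carrier
    ι-monomorphism : IsRingMonomorphism A ring ι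
    fraction       : ∀ x → ∃[ r ] ∃[ s ] ¬ (s A.≈ A.0#) × x * ι s ≈ ι r

-- Meant for 𝔪 a maximal ideal of a Dedekind domain A that is not a field.  Every
-- element of F is a fraction and exponents of nonzero elements exist and are
-- unique, so the two conditions determine w.
record IsAdicValuation
         {c ℓ c′ ℓ′} {A : CommutativeRing c ℓ} (F : FractionField A c′ ℓ′)
         (𝔪 : Ideal A) (w : CommutativeRing.Carrier (FractionField.ring F) → ℤₘ₀)
       : Set (suc (c ⊔ ℓ) ⊔ c′ ⊔ ℓ′) where
  private module A = CommutativeRing A
  open FractionField F using (ring; ι)
  open CommutativeRing ring using (_≈_; _*_; 0#)
  field
    at-zero     : ∀ x → x ≈ 0# → w x ≡ 0ₘ
    at-fraction : ∀ x r s → ¬ (r A.≈ A.0#) → ¬ (s A.≈ A.0#) → x * ι s ≈ ι r →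
                  ∀ a b → IsExponent A 𝔪 r a → IsExponent A 𝔪 s b →
                  w x ≡ of-add (ℤ.- (+ a ℤ.- + b))

record UniformSpace {c ℓ} (X : Setoid c ℓ) p : Set (c ⊔ ℓ ⊔ suc p) where
  open Setoid X using (Carrier; _≈_)
  field
    Entourage  : Pred (Rel Carrier p) p
    universal  : Entourage (λ _ _ → Lift p ⊤)
    enlarge    : ∀ {U V} → Entourage U → U ⇒ V → Entourage V
    intersect  : ∀ {U V} → Entourage U → Entourage V → Entourage (U ∩₂ V)
    reflexive  : ∀ {U} → Entourage U → _≈_ ⇒ U
    symmetric  : ∀ {U} → Entourage U → Entourage (flip U)
    transitive : ∀ {U} → Entourage U → ∃[ V ] Entourage V ×
                 (∀ x y z → V x y → V y z → U x z)

record Filter {c} (X : Set c) p : Set (c ⊔ suc p) where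
  field
    Member    : Pred (Pred X p) p
    universal : Member (λ _ → Lift p ⊤)
    enlarge   : ∀ {P Q} → Member P → P ⊆ Q → Member Q
    intersect : ∀ {P Q} → Member P → Member Q → Member (P ∩ Q)
    proper    : ¬ Member (λ _ → Lift p ⊥)

module _ {c ℓ p} {X : Setoid c ℓ} (𝒰 : UniformSpace X p) where
  open Setoid X using (Carrier; _≈_)
  open UniformSpace 𝒰 using (Entourage)

  IsSeparated : Set (c ⊔ ℓ ⊔ suc p)
  IsSeparated = ∀ x y → (∀ U → Entourage U → U x y) → x ≈ y

  IsCauchy : Filter Carrier p → Set (c ⊔ suc p)
  IsCauchy F = ∀ U → Entourage U →
    ∃[ P ] Filter.Member F P × (∀ x y → P x → P y → U x y)

  _ConvergesTo_ : Filter Carrier p → Carrier → Set (c ⊔ suc p)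
  F ConvergesTo x = ∀ U → Entourage U → Filter.Member F (U x)

  IsComplete : Set (c ⊔ suc p)
  IsComplete = ∀ F → IsCauchy F → ∃[ x ] F ConvergesTo x

  Continuous₁ : (Carrier → Carrier) → Set (c ⊔ suc p)
  Continuous₁ f = ∀ x V → Entourage V →
    ∃[ U ] Entourage U × (∀ x′ → U x x′ → V (f x) (f x′))

  Continuous₂ : (Carrier → Carrier → Carrier) → Set (c ⊔ suc p)
  Continuous₂ f = ∀ x y V → Entourage V →
    ∃[ U ] Entourage U × (∀ x′ y′ → U x x′ → U y y′ → V (f x y) (f x′ y′))

  IsDense : ∀ {a} {A : Set a} → (A → Carrier) → Set (c ⊔ suc p ⊔ a)
  IsDense f = ∀ y V → Entourage V → ∃[ x ] V y (f x)

  -- Basic neighbourhoods in ℤₘ₀: nonzero points are isolated, and 0 has the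
  -- neighbourhoods { z : z ≤ of-add n }.
  BasicNbhd : ℤₘ₀ → ℤ → Pred ℤₘ₀ _
  BasicNbhd ⊥₋    n z = z ≤ₘ of-add n
  BasicNbhd [ m ] n z = z ≡ of-add m

  Continuousᵥ : (Carrier → ℤₘ₀) → Set (c ⊔ suc p)
  Continuousᵥ f = ∀ x n →
    ∃[ U ] Entourage U × (∀ x′ → U x x′ → BasicNbhd (f x) n (f x′))

module _ {c ℓ p c′ ℓ′ p′} {X : Setoid c ℓ} {Y : Setoid c′ ℓ′}
         (𝒰 : UniformSpace X p) (𝒱 : UniformSpace Y p′)
         (f : Setoid.Carrier X → Setoid.Carrier Y) where
  private
    module 𝒰 = UniformSpace 𝒰
    module 𝒱 = UniformSpace 𝒱

  -- The uniform structure of X is the inverse image of that of Y under f.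
  IsUniformInducing : Set (c ⊔ suc p ⊔ c′ ⊔ suc p′)
  IsUniformInducing = ∀ U →
    𝒰.Entourage U ⇔ (∃[ V ] 𝒱.Entourage V × (∀ x y → V (f x) (f y) → U x y))

record Valuation {c ℓ} (A : CommutativeRing c ℓ) : Set (c ⊔ ℓ) where
  open CommutativeRing A using (Carrier; _≈_; _+_; _*_; 0#; 1#)
  field
    val    : Carrier → ℤₘ₀
    v-cong : ∀ {x y} → x ≈ y → val x ≡ val y
    v-0    : val 0# ≡ 0ₘ
    v-1    : val 1# ≡ 1ₘ
    v-*    : ∀ x y → val (x * y) ≡ val x · val y
    v-+    : ∀ x y → val (x + y) ≤ₘ max (val x) (val y)

module _ {c ℓ} {A : CommutativeRing c ℓ} (v : Valuation A) where
  open CommutativeRing A renaming (refl to ≈-refl; sym to ≈-sym; trans to ≈-trans)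
  open RingProperties ring
  open Valuation v

  v-neg : ∀ x → val (- x) ≡ val x
  v-neg x =
    trans (v-cong (≈-sym (-1*x≈-x x)))
    (trans (v-* (- 1#) x)
    (trans (cong (_· val x) v-neg-1) (·-identityˡ (val x))))
    where
    v-neg-1 : val (- 1#) ≡ 1ₘ
    v-neg-1 = square≡1⇒≡1 (val (- 1#))
      (trans (sym (v-* (- 1#) (- 1#)))
      (trans (v-cong (≈-trans (-1*x≈-x (- 1#)) (-‿involutive 1#))) v-1))

  v-sub-sym : ∀ x y → val (x - y) ≡ val (y - x)
  v-sub-sym x y = trans (sym (v-neg (x - y))) (v-cong -[x-y]≈y-x)
    where
    -[x-y]≈y-x : - (x - y) ≈ y - x
    -[x-y]≈y-x = ≈-trans (≈-sym (-‿+-comm x (- y)))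
      (≈-trans (+-congˡ (-‿involutive y)) (+-comm (- x) y))

  v-sub-trans : ∀ x y z n → val (x - y) ≤ₘ n → val (y - z) ≤ₘ n →
                val (x - z) ≤ₘ n
  v-sub-trans x y z n p q = ≤ₘ-respˡ (v-cong telescope)
    (≤ₘ-trans (v-+ (x - y) (y - z)) (max-≤ p q))
    where
    telescope : (x - y) + (y - z) ≈ x - z
    telescope = ≈-trans (+-assoc x (- y) (y - z)) (+-congˡ
      (≈-trans (≈-sym (+-assoc (- y) y (- z)))
      (≈-trans (+-congʳ (-‿inverseˡ y)) (+-identityˡ (- z)))))

  -- Translation invariant, with the sets { x : v x ≤ γ }, γ ≠ 0, as a basis of
  -- neighbourhoods of 0.
  valuationUniformity : UniformSpace setoid (c ⊔ ℓ)
  valuationUniformity = record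
    { Entourage  = λ U → ∃[ n ] (∀ x y → val (x - y) ≤ₘ of-add n → U x y)
    ; universal  = + 0 , λ _ _ _ → lift tt
    ; enlarge    = λ { (n , h) U⇒V → n , λ x y p → U⇒V (h x y p) }
    ; intersect  = λ { (m , h) (n , k) → m ℤ.⊓ n , λ x y p →
                       h x y (≤ₘ-trans p ≤.[ ℤ.i⊓j≤i m n ]) ,
                       k x y (≤ₘ-trans p ≤.[ ℤ.i⊓j≤j m n ]) }
    ; reflexive  = λ { (n , h) {x} {y} x≈y →
                       h x y (≤ₘ-respˡ (sym (trans (v-cong (x≈y⇒x-y≈0 x≈y)) v-0))
                                       (≤.⊥₋≤ _)) }
    ; symmetric  = λ { (n , h) →
                       n , λ x y p → h y x (≤ₘ-respˡ (v-sub-sym x y) p) }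
    ; transitive = λ { (n , h) →
                       (λ x y → Lift (c ⊔ ℓ) (val (x - y) ≤ₘ of-add n)) ,
                       (n , λ _ _ p → lift p) ,
                       λ { x y z (lift p) (lift q) →
                           h x z (v-sub-trans x y z _ p q) } }
    }
    where
    x≈y⇒x-y≈0 : ∀ {x y} → x ≈ y → x - y ≈ 0#
    x≈y⇒x-y≈0 {y = y} e = ≈-trans (+-congʳ e) (-‿inverseʳ y)

-- A complete separated uniform space in which F, with the uniform structure of
-- v, embeds densely.  Continuity of the field operations makes them the
-- extensions by continuity of those of F.
record Completion {c ℓ} {F : CommutativeRing c ℓ} (v : Valuation F) c′ ℓ′
       : Set (c ⊔ ℓ ⊔ suc (c ⊔ ℓ ⊔ c′ ⊔ ℓ′)) where
  field
    ring       : CommutativeRing c′ ℓ′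
    isField    : IsField ring
  open CommutativeRing ring using (Carrier; setoid; _≈_; _+_; _*_; -_; 0#; 1#)
  field
    uniformity : UniformSpace setoid (c′ ⊔ ℓ′)

    +-continuous       : Continuous₂ uniformity _+_
    *-continuous       : Continuous₂ uniformity _*_
    neg-continuous     : Continuous₁ uniformity -_
    inverse-continuous : let open UniformSpace uniformity using (Entourage) in
      ∀ x y → x * y ≈ 1# → ∀ V → Entourage V →
      ∃[ U ] Entourage U × (∀ x′ y′ → x′ * y′ ≈ 1# → U x x′ → V y y′)

    separated : IsSeparated uniformity
    complete  : IsComplete uniformity

    ι              : CommutativeRing.Carrier F → Carrier
    ι-homomorphism : IsRingHomomorphism F ring ι
    ι-inducing     : IsUniformInducing (valuationUniformity v) uniformity ι
    ι-dense        : IsDense uniformity ι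

-- By density there is only one continuous extension of v.
record ExtensionByContinuity
         {c ℓ c′ ℓ′} {F : CommutativeRing c ℓ} {v : Valuation F}
         (F̂ : Completion v c′ ℓ′) : Set (c ⊔ suc (c′ ⊔ ℓ′)) where
  open Completion F̂ using (ring; uniformity; ι)
  field
    valuation : Valuation ring
  open Valuation valuation public using (val)
  field
    extends    : ∀ x → val (ι x) ≡ Valuation.val v x
    continuous : Continuousᵥ uniformity val

module _ {c ℓ} {F : CommutativeRing c ℓ} (v : Valuation F) where
  open CommutativeRing F renaming (refl to ≈-refl; sym to ≈-sym; trans to ≈-trans)
  open Valuation v

  integers : CommutativeRing c ℓ
  integers = record
    { Carrier = Σ Carrier λ x → val x ≤ₘ 1ₘ
    ; _≈_     = λ x y → proj₁ x ≈ proj₁ y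
    ; _+_     = λ { (x , p) (y , q) → x + y , ≤ₘ-trans (v-+ x y) (max-≤ p q) }
    ; _*_     = λ { (x , p) (y , q) → x * y , ≤ₘ-respˡ (sym (v-* x y)) (·-≤1 p q) }
    ; -_      = λ { (x , p) → - x , ≤ₘ-respˡ (sym (v-neg v x)) p }
    ; 0#      = 0# , ≤ₘ-respˡ (sym v-0) (≤.⊥₋≤ _)
    ; 1#      = 1# , ≤ₘ-respˡ (sym v-1) ≤ₘ-refl
    ; isCommutativeRing = record
      { isRing = record
        { +-isAbelianGroup = record
          { isGroup = record
            { isMonoid = record
              { isSemigroup = record
                { isMagma = record
                  { isEquivalence = record
                    { refl = ≈-refl ; sym = ≈-sym ; trans = ≈-trans }
                  ; ∙-cong = +-cong
                  }
                ; assoc = λ _ _ _ → +-assoc _ _ _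
                }
              ; identity = (λ _ → +-identityˡ _) , (λ _ → +-identityʳ _)
              }
            ; inverse = (λ _ → -‿inverseˡ _) , (λ _ → -‿inverseʳ _)
            ; ⁻¹-cong = -‿cong
            }
          ; comm = λ _ _ → +-comm _ _
          }
        ; *-cong     = *-cong
        ; *-assoc    = λ _ _ _ → *-assoc _ _ _
        ; *-identity = (λ _ → *-identityˡ _) , (λ _ → *-identityʳ _)
        ; distrib    = (λ _ _ _ → distribˡ _ _ _) , (λ _ _ _ → distribʳ _ _ _)
        }
      ; *-comm = λ _ _ → *-comm _ _
      }
    }

  private
    cofactor-≤1 : ∀ {a b} → ¬ (a ≤ₘ 1ₘ) → a · b ≡ 1ₘ → b ≤ₘ 1ₘ
    cofactor-≤1 {⊥₋} a≰1 _ = ⊥-elim (a≰1 (≤.⊥₋≤ _))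
    cofactor-≤1 {[ m ]} {⊥₋} _ _ = ≤.⊥₋≤ _
    cofactor-≤1 {[ m ]} {[ n ]} a≰1 e with ℤ.≤-total n (+ 0)
    ... | inj₁ n≤0 = ≤.[ n≤0 ]
    ... | inj₂ 0≤n = ⊥-elim (a≰1 ≤.[ ℤ.≤-trans m≤m+n (ℤ.≤-reflexive ([]-inj e)) ])
      where
      []-inj : ∀ {i j : ℤ} → of-add i ≡ of-add j → i ≡ j
      []-inj refl = refl
      m≤m+n : m ℤ.≤ m ℤ.+ n
      m≤m+n = subst (ℤ._≤ m ℤ.+ n) (ℤ.+-identityʳ m) (ℤ.+-monoʳ-≤ m 0≤n)

  module _ (isField : IsField F) where

    private
      fraction : ∀ x → ∃[ r ] ∃[ s ]
        ¬ (CommutativeRing._≈_ integers s (CommutativeRing.0# integers)) ×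
        x * proj₁ s ≈ proj₁ r
      fraction x with ≤.≤₋-dec ℤ._≤?_ (val x) 1ₘ
      ... | yes p = (x , p) , CommutativeRing.1# integers , proj₁ isField , *-identityʳ x
      ... | no x≰1 = CommutativeRing.1# integers , (y , y≤1) , y≉0 , xy≈1
        where
        x≉0 : ¬ (x ≈ 0#)
        x≉0 e = x≰1 (≤ₘ-respˡ (sym (trans (v-cong e) v-0)) (≤.⊥₋≤ _))
        y : Carrier
        y = proj₁ (proj₂ isField x x≉0)
        xy≈1 : x * y ≈ 1#
        xy≈1 = proj₂ (proj₂ isField x x≉0)
        y≤1 : val y ≤ₘ 1ₘ
        y≤1 = cofactor-≤1 x≰1 (trans (sym (v-* x y)) (trans (v-cong xy≈1) v-1))
        y≉0 : ¬ (y ≈ 0#)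
        y≉0 e = proj₁ isField
          (≈-trans (≈-sym xy≈1) (≈-trans (*-congˡ e) (zeroʳ x)))

    integers-fractionField : FractionField integers c ℓ
    integers-fractionField = record
      { ring           = F
      ; isField        = isField
      ; ι              = proj₁
      ; ι-monomorphism = record
        { isRingHomomorphism = record
          { isSemiringHomomorphism = record
            { isNearSemiringHomomorphism = record
              { +-isMonoidHomomorphism = record
                { isMagmaHomomorphism = record
                  { isRelHomomorphism = record { cong = λ e → e }
                  ; homo = λ _ _ → ≈-refl
                  }
                ; ε-homo = ≈-refl
                }
              ; *-homo = λ _ _ → ≈-refl
              }
            ; 1#-homo = ≈-refl
            }
          ; -‿homo = λ _ → ≈-refl
          }
        ; injective = λ e → e
        }
      ; fraction = fraction
      }

module _ {c ℓ c′ ℓ′} {F : CommutativeRing c ℓ} {v : Valuation F}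
         {F̂ : Completion v c′ ℓ′} (v̂ : ExtensionByContinuity F̂) where

  infix 9 _°

  _° : CommutativeRing c′ ℓ′
  _° = integers (ExtensionByContinuity.valuation v̂)

  °-fractions : FractionField _° c′ ℓ′
  °-fractions = integers-fractionField
    (ExtensionByContinuity.valuation v̂) (Completion.isField F̂)

{-# OPTIONS --safe #-}

-- An element ϖ of value of-add (-1) in a valued field F generates every maximal
-- ideal of the valuation ring, and then the n-th power of that ideal is
-- { y : v y ≤ of-add (-n) }, which is (r) for each r of value of-add (-n).  So
-- the adic valuation is v.  For F = K̂ the image of a generator of 𝔪_R is such a
-- ϖ, because v̂ extends v and v is 𝔪_R-adic.

module Submission where

open import Defs
open import Level using (Level; _⊔_; lift)
open import Algebra.Bundles using (CommutativeRing)
open import Data.Empty using (⊥-elim)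
open import Data.Integer.Base as ℤ using (+_; -[1+_]; +≤+; -≤-)
import Data.Integer.Properties as ℤ
open import Data.List.Base using ([]; _∷_; replicate)
open import Data.List.Relation.Unary.All using ([]; _∷_)
open import Data.List.Relation.Unary.All.Properties using (replicate⁺)
open import Data.Nat.Base as ℕ using (ℕ; z≤n)
open import Data.Product.Base using (∃-syntax; _×_; _,_; proj₁; proj₂)
open import Data.Sum.Base using (_⊎_; inj₁; inj₂)
open import Relation.Binary.Construct.Add.Infimum.NonStrict ℤ._≤_ using (⊥₋≤_; [_])
open import Relation.Binary.PropositionalEquality
  using (_≡_; refl; sym; trans; cong; cong₂; subst; module ≡-Reasoning)
open import Relation.Nullary.Construct.Add.Infimum using (⊥₋; [_])
open import Relation.Nullary.Decidable.Core using (Dec; yes; no; decidable-stable)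
open import Relation.Nullary.Negation using (¬_)

-- Arithmetic and discreteness of `ℤₘ₀`.

·-assoc : ∀ x y z → (x · y) · z ≡ x · (y · z)
·-assoc ⊥₋    _     _     = refl
·-assoc [ _ ] ⊥₋    _     = refl
·-assoc [ _ ] [ _ ] ⊥₋    = refl
·-assoc [ a ] [ b ] [ c ] = cong [_] (ℤ.+-assoc a b c)

·-identityʳ : ∀ x → x · 1ₘ ≡ x
·-identityʳ ⊥₋    = refl
·-identityʳ [ n ] = cong [_] (ℤ.+-identityʳ n)

·-mono-≤ : ∀ {x y a b} → x ≤ₘ a → y ≤ₘ b → x · y ≤ₘ a · b
·-mono-≤ (⊥₋≤ _) _       = ⊥₋≤ _
·-mono-≤ [ _ ]   (⊥₋≤ _) = ⊥₋≤ _
·-mono-≤ [ p ]   [ q ]   = [ ℤ.+-mono-≤ p q ]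

of-add-neg-suc : ∀ n → of-add -[1+ 0 ] · of-add (ℤ.- + n) ≡ of-add (ℤ.- + ℕ.suc n)
of-add-neg-suc ℕ.zero    = refl
of-add-neg-suc (ℕ.suc n) = refl

≤1⇒≡0⊎neg : ∀ {x} → x ≤ₘ 1ₘ → x ≡ 0ₘ ⊎ (∃[ k ] x ≡ of-add (ℤ.- + k))
≤1⇒≡0⊎neg {⊥₋}            _          = inj₁ refl
≤1⇒≡0⊎neg {[ + 0 ]}       _          = inj₂ (0 , refl)
≤1⇒≡0⊎neg {[ + ℕ.suc _ ]} [ +≤+ () ]
≤1⇒≡0⊎neg {[ -[1+ k ] ]}  _          = inj₂ (ℕ.suc k , refl)

-- The value group is discrete: a value below `1ₘ` is already at most that of a uniformizer.
≤1⇒≡1⊎≤-1 : ∀ {x} → x ≤ₘ 1ₘ → x ≡ 1ₘ ⊎ x ≤ₘ of-add -[1+ 0 ]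
≤1⇒≡1⊎≤-1 p with ≤1⇒≡0⊎neg p
... | inj₁ refl             = inj₂ (⊥₋≤ _)
... | inj₂ (0 , refl)       = inj₁ refl
... | inj₂ (ℕ.suc _ , refl) = inj₂ [ -≤- z≤n ]

-- Brings `val x · val s ≡ val r`, for a fraction `x` = r/s, into the shape that `at-fraction`
-- prescribes.
·-cancel-neg : ∀ {n} a b → of-add n · of-add (ℤ.- + b) ≡ of-add (ℤ.- + a) →
               of-add (ℤ.- (+ a ℤ.- + b)) ≡ of-add n
·-cancel-neg {n} a b e = begin
  of-add (ℤ.- (+ a ℤ.- + b))              ≡⟨ cong of-add (ℤ.neg-distrib-+ (+ a) (ℤ.- + b)) ⟩
  of-add (ℤ.- + a) · of-add (ℤ.- ℤ.- + b) ≡⟨ cong (_· of-add (ℤ.- ℤ.- + b)) e ⟨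
  of-add n · of-add (ℤ.- + b) · of-add (ℤ.- ℤ.- + b)
    ≡⟨ cong of-add (ℤ.+-assoc n (ℤ.- + b) (ℤ.- ℤ.- + b)) ⟩
  of-add (n ℤ.+ (ℤ.- + b ℤ.- ℤ.- + b))
    ≡⟨ cong (λ k → of-add (n ℤ.+ k)) (ℤ.+-inverseʳ (ℤ.- + b)) ⟩
  of-add n · 1ₘ                           ≡⟨ ·-identityʳ (of-add n) ⟩
  of-add n                                ∎
  where open ≡-Reasoning

≟0ₘ : ∀ x → Dec (x ≡ 0ₘ)
≟0ₘ ⊥₋    = yes refl
≟0ₘ [ _ ] = no λ ()

-- Products of ideals and simple exponents.

module _ {c ℓ} {A : CommutativeRing c ℓ} where
  open CommutativeRing A renaming (refl to ≈-refl; sym to ≈-sym; trans to ≈-trans)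
  open Ideal

  multiplicity-replicate : ∀ (𝔪 : Ideal A) n →
                           Multiplicity A 𝔪 (replicate n 𝔪) n
  multiplicity-replicate 𝔪 ℕ.zero    = []
  multiplicity-replicate 𝔪 (ℕ.suc n) =
    hit ((λ i → i) , λ i → i) (multiplicity-replicate 𝔪 n)

  *ᴵ-⊆ˡ : ∀ {I J x} → members (_*ᴵ_ A I J) x → members I x
  *ᴵ-⊆ˡ {I} (empty-sum e) = resp I (≈-sym e) (has-0 I)
  *ᴵ-⊆ˡ {I} (add-term a b i _ m e) = resp I (≈-sym e)
    (+-closed I (resp I (*-comm b a) (absorb I b i)) (*ᴵ-⊆ˡ m))

  *ᴵ-∋-* : ∀ {I J x} a b → members I a → members J b → x ≈ a * b →
           members (_*ᴵ_ A I J) x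
  *ᴵ-∋-* a b i j e =
    add-term a b i j (empty-sum ≈-refl) (≈-trans e (≈-sym (+-identityʳ _)))

  exponent-generator : ∀ {𝔪 g} → IsMaximal A 𝔪 → _≐ᴵ_ A 𝔪 (principal A g) →
                       IsExponent A 𝔪 g 1
  exponent-generator {𝔪} max (⊆g , g⊆) =
    𝔪 ∷ [] , max ∷ [] ,
    ( (λ m → ⊆g (*ᴵ-⊆ˡ m))
    , (λ m → *ᴵ-∋-* _ 1# (g⊆ m) (lift _) (≈-sym (*-identityʳ _)))) ,
    multiplicity-replicate 𝔪 1

  exponent-1 : ∀ {𝔪} → IsExponent A 𝔪 1# 0
  exponent-1 =
    [] , [] , ((λ {x} _ → x , ≈-sym (*-identityʳ x)) , λ _ → lift _) , []

-- Uniformizers of a discrete valuation ring.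

module _ {c ℓ} (A : CommutativeRing c ℓ) where
  open CommutativeRing A renaming (refl to ≈-refl; sym to ≈-sym; trans to ≈-trans)

  -- A generator of the ideal { y : y ≈ 0 or P } decides P.
  principal⇒excludedMiddle : ¬ (1# ≈ 0#) →
    (∀ I → ∃[ g ] _≐ᴵ_ A I (principal A g)) →
    ∀ (P : Set (c ⊔ ℓ)) → Dec P
  principal⇒excludedMiddle 1≉0 isPrincipal P = decide (isPrincipal I)
    where
    I : Ideal A
    I = record
      { members  = λ y → y ≈ 0# ⊎ P
      ; resp     = λ { e (inj₁ p) → inj₁ (≈-trans (≈-sym e) p) ; e (inj₂ p) → inj₂ p }
      ; has-0    = inj₁ ≈-refl
      ; +-closed = λ { (inj₁ p) (inj₁ q) → inj₁ (≈-trans (+-cong p q) (+-identityˡ 0#))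
                     ; (inj₂ p) _ → inj₂ p
                     ; (inj₁ _) (inj₂ q) → inj₂ q }
      ; absorb   = λ { a (inj₁ p) → inj₁ (≈-trans (*-congˡ p) (zeroʳ a))
                     ; a (inj₂ p) → inj₂ p }
      }
    decide : ∃[ g ] _≐ᴵ_ A I (principal A g) → Dec P
    decide (g , I⊆g , g⊆I) with g⊆I (1# , ≈-sym (*-identityˡ g))
    ... | inj₂ p   = yes p
    ... | inj₁ g≈0 = no λ p → let (a , 1≈ag) = I⊆g {1#} (inj₂ p) in
      1≉0 (≈-trans 1≈ag (≈-trans (*-congˡ g≈0) (zeroʳ a)))

module _ {c ℓ} (R : DiscreteValuationRing c ℓ) where
  open DiscreteValuationRing R
  open CommutativeRing ring renaming (refl to ≈-refl; sym to ≈-sym; trans to ≈-trans)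
    hiding (ring)

  -- If `g` were zero, the maximal ideal would vanish. For nonzero `x` the ideal (x) contains it
  -- strictly, so (x) would not be proper, `x` would be invertible and the ring a field.
  DVR-generator≉0 : ∀ {g} → _≐ᴵ_ ring maximalIdeal (principal ring g) → ¬ (g ≈ 0#)
  DVR-generator≉0 {g} (𝔪⊆g , _) g≈0 = notField (1≉0 , inverse)
    where
    1≉0 : ¬ (1# ≈ 0#)
    1≉0 = proj₁ isIntegralDomain
    𝔪≈0 : ∀ {y} → Ideal.members maximalIdeal y → y ≈ 0#
    𝔪≈0 m = let (a , e) = 𝔪⊆g m in ≈-trans e (≈-trans (*-congˡ g≈0) (zeroʳ a))
    inverse : ∀ x → ¬ (x ≈ 0#) → ∃[ y ] x * y ≈ 1#
    inverse x x≉0 =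
      -- Maximality only refutes that (x) is proper; excluded middle turns this into an actual
      -- inverse.
      let (y , e) = decidable-stable
            (principal⇒excludedMiddle ring 1≉0 isPrincipal
              (Ideal.members (principal ring x) 1#))
            λ proper → x≉0 (𝔪≈0 (proj₁
              (proj₂ isMaximal (principal ring x) proper
                λ m → Ideal.resp (principal ring x) (≈-sym (𝔪≈0 m))
                        (Ideal.has-0 (principal ring x)))
              (1# , ≈-sym (*-identityˡ x))))
      in y , ≈-trans (*-comm x y) (≈-sym e)

  -- A generator of the maximal ideal is the fraction g/1, with exponents 1 and 0.
  adic-uniformizer : ∀ {c′ ℓ′} (K : FractionField ring c′ ℓ′)
    (w : CommutativeRing.Carrier (FractionField.ring K) → ℤₘ₀) →
    IsAdicValuation K maximalIdeal w → ∃[ ϖ ] w ϖ ≡ of-add -[1+ 0 ]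
  adic-uniformizer K w adic = let (g , 𝔪≐g) = isPrincipal maximalIdeal in
    ι g , IsAdicValuation.at-fraction adic (ι g) g 1#
      (DVR-generator≉0 𝔪≐g) (proj₁ isIntegralDomain)
      (K.trans (K.sym (*-homo g 1#)) (⟦⟧-cong (*-identityʳ g)))
      1 0 (exponent-generator isMaximal 𝔪≐g) exponent-1
    where
    open FractionField K using (ι; ι-monomorphism)
    module K = CommutativeRing (FractionField.ring K)
    open IsRingMonomorphism ring (FractionField.ring K) ι-monomorphism
      using (*-homo; ⟦⟧-cong)

-- Ideals and exponents in the valuation ring of a valued field.

module _ {c ℓ} {F : CommutativeRing c ℓ} (isField : IsField F) (v : Valuation F) where
  open CommutativeRing F renaming (refl to ≈-refl; sym to ≈-sym; trans to ≈-trans)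
  open Valuation v

  val≡of-add⇒≉0 : ∀ {x n} → val x ≡ of-add n → ¬ (x ≈ 0#)
  val≡of-add⇒≉0 e x≈0 with () ← trans (sym e) (trans (v-cong x≈0) v-0)

  -- `x` has an inverse, and the absorbing `0ₘ` is no factor of `1ₘ`.
  ≉0⇒val≢0 : ∀ {x} → ¬ (x ≈ 0#) → ¬ (val x ≡ 0ₘ)
  ≉0⇒val≢0 {x} x≉0 e with (y , xy≈1) ← proj₂ isField x x≉0
    with () ← trans (cong (_· val y) (sym e)) (trans (sym (v-* x y)) (trans (v-cong xy≈1) v-1))

  integer-val : ∀ {r} → ¬ (r ≈ 0#) → val r ≤ₘ 1ₘ → ∃[ k ] val r ≡ of-add (ℤ.- + k)
  integer-val r≉0 r≤1 with ≤1⇒≡0⊎neg r≤1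
  ... | inj₁ vr≡0 = ⊥-elim (≉0⇒val≢0 r≉0 vr≡0)
  ... | inj₂ p    = p

  -- The quotient is `y * b⁻¹`. With `α` equal to `1ₘ` this is divisibility in the valuation ring;
  -- general `α` keeps the bound on the cofactor that the induction on powers of `𝔪` consumes.
  divide : ∀ {b n} y α → val b ≡ of-add n → val y ≤ₘ α · of-add n →
           ∃[ z ] y ≈ z * b × val z ≤ₘ α
  divide {b} {n} y α vb p with (b⁻¹ , bb⁻¹≈1) ← proj₂ isField b (val≡of-add⇒≉0 vb) =
    y * b⁻¹ ,
    ≈-sym (≈-trans (*-assoc y b⁻¹ b) (≈-trans (*-congˡ (≈-trans (*-comm b⁻¹ b) bb⁻¹≈1)) (*-identityʳ y))) ,
    ≤ₘ-respˡ (sym (v-* y b⁻¹))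
      (subst (val y · val b⁻¹ ≤ₘ_) cancel (·-mono-≤ p (≤ₘ-refl {val b⁻¹})))
    where
    cancel : (α · of-add n) · val b⁻¹ ≡ α
    cancel = trans (·-assoc α (of-add n) (val b⁻¹)) (trans
      (cong (α ·_) (trans (cong (_· val b⁻¹) (sym vb))
        (trans (sym (v-* b b⁻¹)) (trans (v-cong bb⁻¹≈1) v-1))))
      (·-identityʳ α))

  private
    O = integers v
    module O = CommutativeRing O
    _∈_ : O.Carrier → Ideal O → Set _
    x ∈ I = Ideal.members I x

  product-val-≤ : ∀ {I J α β} →
    (∀ {a} → a ∈ I → val (proj₁ a) ≤ₘ α) →
    (∀ {b} → b ∈ J → val (proj₁ b) ≤ₘ β) →
    ∀ {y} → y ∈ _*ᴵ_ O I J → val (proj₁ y) ≤ₘ α · β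
  product-val-≤ f g (empty-sum e) = ≤ₘ-respˡ (sym (trans (v-cong e) v-0)) (⊥₋≤ _)
  product-val-≤ f g (add-term a b i j m e) = ≤ₘ-respˡ (sym (v-cong e))
    (≤ₘ-trans (v-+ _ _) (max-≤
      (≤ₘ-respˡ (sym (v-* (proj₁ a) (proj₁ b))) (·-mono-≤ (f i) (g j)))
      (product-val-≤ f g m)))

  module _ {𝔪 : Ideal O} (maximal : IsMaximal O 𝔪)
           {ϖ : Carrier} (vϖ : val ϖ ≡ of-add -[1+ 0 ]) where

    -- By discreteness the only other value is `1ₘ`. Such an element is a unit of the valuation
    -- ring, so `𝔪` would contain 1.
    𝔪⇒val≤ : ∀ {y} → y ∈ 𝔪 → val (proj₁ y) ≤ₘ of-add -[1+ 0 ]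
    𝔪⇒val≤ {y , y≤1} m with ≤1⇒≡1⊎≤-1 y≤1
    ... | inj₂ p  = p
    ... | inj₁ vy with (z , 1≈zy , z≤1) ← divide 1# 1ₘ vy (≤ₘ-respˡ (sym v-1) ≤ₘ-refl) =
      ⊥-elim (proj₁ maximal (Ideal.resp 𝔪 (≈-sym 1≈zy) (Ideal.absorb 𝔪 (z , z≤1) m)))

    ϖᵒ : O.Carrier
    ϖᵒ = ϖ , ≤ₘ-respˡ (sym vϖ) [ ℤ.-≤+ ]

    -- The ideal (ϖ) is proper, since its elements have value below `1ₘ`, and contains `𝔪` by
    -- division; maximality makes the two equal.
    ϖ∈𝔪 : ϖᵒ ∈ 𝔪
    ϖ∈𝔪 = proj₁ (proj₂ maximal (principal O ϖᵒ) proper ⊇𝔪) (O.1# , ≈-sym (*-identityˡ ϖ))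
      where
      proper : IsProper O (principal O ϖᵒ)
      proper ((a , a≤1) , 1≈aϖ) with [ () ] ← ≤ₘ-respˡ
        (trans (sym (v-* a ϖ)) (trans (v-cong (≈-sym 1≈aϖ)) v-1))
        (·-mono-≤ a≤1 (≤ₘ-respˡ (sym vϖ) ≤ₘ-refl))
      ⊇𝔪 : ∀ {y} → y ∈ 𝔪 → y ∈ principal O ϖᵒ
      ⊇𝔪 {y , _} m with (z , e , z≤1) ← divide y 1ₘ vϖ (𝔪⇒val≤ m) = (z , z≤1) , e

    power⇒val≤ : ∀ n {y} → y ∈ ∏ O (replicate n 𝔪) → val (proj₁ y) ≤ₘ of-add (ℤ.- + n)
    power⇒val≤ ℕ.zero    {_ , y≤1} _ = y≤1
    power⇒val≤ (ℕ.suc n) {y} m =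
      subst (val (proj₁ y) ≤ₘ_) (of-add-neg-suc n) (product-val-≤ 𝔪⇒val≤ (power⇒val≤ n) m)

    -- Each induction step splits off one factor `ϖ`, so a single product suffices instead of a sum.
    val≤⇒power : ∀ n {y} → val (proj₁ y) ≤ₘ of-add (ℤ.- + n) → y ∈ ∏ O (replicate n 𝔪)
    val≤⇒power ℕ.zero    _ = lift _
    val≤⇒power (ℕ.suc n) {y , _} p
      with (z , e , z≤) ← divide y (of-add (ℤ.- + n)) vϖ
             (subst (val y ≤ₘ_)
               (trans (sym (of-add-neg-suc n)) (cong of-add (ℤ.+-comm -[1+ 0 ] (ℤ.- + n)))) p) =
      *ᴵ-∋-* ϖᵒ zᵒ ϖ∈𝔪 (val≤⇒power n {zᵒ} z≤) (≈-trans e (*-comm z ϖ))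
      where
      zᵒ : O.Carrier
      zᵒ = z , ≤ₘ-trans z≤ [ ℤ.neg-≤-pos {n} ]

    -- The factorization is `𝔪` repeated `n` times: that power and (r) both consist of the elements
    -- of value at most `val r`.
    exponent-val : ∀ {r n} → val (proj₁ r) ≡ of-add (ℤ.- + n) → IsExponent O 𝔪 r n
    exponent-val {r , r≤1} {n} vr =
      replicate n 𝔪 , replicate⁺ n maximal , (⊆r , r⊆) , multiplicity-replicate 𝔪 n
      where
      ⊆r : ∀ {y} → y ∈ ∏ O (replicate n 𝔪) → y ∈ principal O (r , r≤1)
      ⊆r {y , _} m
        with (z , e , z≤1) ← divide y 1ₘ vr
               (subst (val y ≤ₘ_) (sym (·-identityˡ _)) (power⇒val≤ n m)) = (z , z≤1) , e
      r⊆ : ∀ {y} → y ∈ principal O (r , r≤1) → y ∈ ∏ O (replicate n 𝔪)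
      r⊆ ((a , a≤1) , e) = val≤⇒power n (≤ₘ-respˡ (sym (trans (v-cong e) (v-* a r)))
        (subst (val a · val r ≤ₘ_) (trans (·-identityˡ (val r)) vr) (·-mono-≤ a≤1 (≤ₘ-refl {val r}))))

    adic≡val : ∀ {w} → IsAdicValuation (integers-fractionField v isField) 𝔪 w →
               ∀ x → w x ≡ val x
    adic≡val {w} adic x = by-value (val x) refl
      where
      open IsAdicValuation adic
      open FractionField (integers-fractionField v isField) using (fraction)
      by-value : ∀ α → val x ≡ α → w x ≡ α
      -- val x ≡ 0ₘ yields x ≈ 0# only up to double negation.
      by-value ⊥₋ vx = decidable-stable (≟0ₘ (w x)) λ wx≢0 →
        ≉0⇒val≢0 (λ x≈0 → wx≢0 (at-zero x x≈0)) vx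
      by-value [ n ] vx
        with (r , r≤1) , (s , s≤1) , s≉0 , xs≈r ← fraction x
        with (b , vs) ← integer-val s≉0 s≤1
        -- The value of `r` is a product of two nonzero values; hence `r` is nonzero, as
        -- `at-fraction` demands.
        with vr ← trans (v-cong (≈-sym xs≈r)) (trans (v-* x s) (cong₂ _·_ vx vs))
        with r≉0 ← val≡of-add⇒≉0 vr
        with (a , vr′) ← integer-val r≉0 r≤1 =
        trans (at-fraction x (r , r≤1) (s , s≤1) r≉0 s≉0 xs≈r a b
                (exponent-val {r , r≤1} vr′) (exponent-val {s , s≤1} vs))
              (·-cancel-neg a b (trans (sym vr) vr′))

mainTheorem5 : ∀ {c ℓ c₁ ℓ₁ c₂ ℓ₂ : Level}
    (R : DiscreteValuationRing c ℓ)
    (K : FractionField (DiscreteValuationRing.ring R) c₁ ℓ₁)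
    (v : Valuation (FractionField.ring K)) →
    IsAdicValuation K (DiscreteValuationRing.maximalIdeal R) (Valuation.val v) →
    (K̂ : Completion v c₂ ℓ₂)
    (v̂ : ExtensionByContinuity K̂)
    (𝔪̂ : Ideal (v̂ °)) →
    IsMaximal (v̂ °) 𝔪̂ →
    (v-𝔪̂ : CommutativeRing.Carrier (Completion.ring K̂) → ℤₘ₀) →
    IsAdicValuation (°-fractions v̂) 𝔪̂ v-𝔪̂ →
    ∀ x → v-𝔪̂ x ≡ ExtensionByContinuity.val v̂ x
mainTheorem5 R K v v-adic K̂ v̂ 𝔪̂ maximal v-𝔪̂ adic
  with (ϖ , vϖ) ← adic-uniformizer R K (Valuation.val v) v-adic =
  adic≡val (Completion.isField K̂) (ExtensionByContinuity.valuation v̂) {𝔪̂} maximal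
    {Completion.ι K̂ ϖ} (trans (ExtensionByContinuity.extends v̂ ϖ) vϖ) adic
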